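{- There exists a finite weighted directed graph $G$ without self-loops, with positive edge weights and ultrametric backbone $U$, such that the union $\mathcal{A}$ of all minimum spanning arborescences of $G$ (over all root nodes) satisfies both: (i) $\mathcal{A}$ lacks some edge belonging to $U$; and (ii) $\mathcal{A}$ has some edge that is not in $U$.
   Context: A weighted directed (distance) graph $G=(X,D)$ has node set $X$ and, for each ordered pair of nodes $(x_i,x_j)$, a weight $d_{i,j}\in[0,\infty]$. A finite value $d_{i,j}$ means that there is a directed edge from $x_i$ to $x_j$ of weight $d_{i,j}$; $d_{i,j}=\infty$ means there is no such edge. All edges therefore have finite weight, and (directed) paths use only edges. Positive edge weights means every edge has weight $>0$. The weight of a graph is the sum of the weights of its edges. The ultrametric backbone $U=(X,B^{\max})$ of $G$ is the subgraph of $G$ on the same node set $X$ whose edges are exactly the edges $(x_i,x_j)$ of $G$ satisfying $d_{i,j}=d^{\mathcal U}_{i,j}$, where $d^{\mathcal U}_{i,j}=\min_{\pi}\max_{(x_k,x_l)\in\pi}d_{k,l}$, the minimum being over all directed paths $\pi$ in $G$ from $x_i$ to $x_j$. Equivalently, an edge $(x_i,x_j)$ of $G$ is removed if and only if there is a directed path in $G$ from $x_i$ to $x_j$ all of whose edges have weight strictly less than $d_{i,j}$. A minimum spanning arborescence of $G$ at a root node $x_r\in X$ is a directed acyclic subgraph of $G$ rooted at $x_r$ that preserves reachability from $x_r$ to all other nodes (every node other than $x_r$ that is reachable from $x_r$ by a directed path in $G$ is reachable from $x_r$ in the subgraph) and is of minimum weight among such subgraphs. The union $\mathcal{A}$ is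 taken over all minimum spanning arborescences at all roots $x_r\in X$; its edges are those belonging to at least one of them. -}

module Defs where

open import Data.Bool using (if_then_else_)
open import Data.Fin using (Fin)
open import Data.Fin.Subset using (Subset; _∈_)
open import Data.Integer using (+_)
import Data.Integer.Solver as ℤSolver
open import Data.Maybe using (Maybe; just; nothing; fromMaybe)
open import Data.Nat as ℕ using (ℕ; suc)
open import Data.Product using (Σ; ∃; _×_; _,_; proj₁)
open import Data.Rational.Unnormalised as ℚ using (ℚᵘ; mkℚᵘ; 0ℚᵘ; _≃_; *≡*)
import Data.Rational.Unnormalised.Properties as ℚₚ
open import Data.Rational.Unnormalised.Solver using (module +-*-Solver)
open import Data.Vec using (lookup)
open import Data.Vec.Functional using (foldr)
open import Relation.Binary.Construct.Closure.Transitive using (TransClosure; [_]; _∷_)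
open import Relation.Binary.PropositionalEquality using (_≡_; _≢_; refl)
open import Relation.Nullary using (¬_)

-- Real numbers, after Bishop: regular sequences of rationals, with indices
-- shifted so that they start at 0.

1/1+_ : ℕ → ℚᵘ
1/1+ n = mkℚᵘ (+ 1) n

-- |xₘ - xₙ| ≤ 1/(m+1) + 1/(n+1); the absolute value is captured by letting
-- m and n trade places.
Regular : (ℕ → ℚᵘ) → Set
Regular x = ∀ m n → x m ℚ.≤ x n ℚ.+ (1/1+ m ℚ.+ 1/1+ n)

record ℝ : Set where
  constructor mkℝ
  field
    approx  : ℕ → ℚᵘ
    regular : Regular approx

open ℝ public

infix 4 _≤_ _<_ _≈_
infixl 6 _+_ _⊔_

_≤_ : ℝ → ℝ → Set
x ≤ y = ∀ n → approx x n ℚ.≤ approx y n ℚ.+ (1/1+ n ℚ.+ 1/1+ n)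

_<_ : ℝ → ℝ → Set
x < y = ∃ λ n → approx x n ℚ.+ (1/1+ n ℚ.+ 1/1+ n) ℚ.< approx y n

_≈_ : ℝ → ℝ → Set
x ≈ y = x ≤ y × y ≤ x

private
  1/1+-nonNeg : ∀ n → 0ℚᵘ ℚ.≤ 1/1+ n
  1/1+-nonNeg n = ℚₚ.nonNegative⁻¹ (1/1+ n)

  p≤p+ε : ∀ p m n → p ℚ.≤ p ℚ.+ (1/1+ m ℚ.+ 1/1+ n)
  p≤p+ε p m n = ℚₚ.≤-trans
    (ℚₚ.≤-reflexive (ℚₚ.≃-sym (ℚₚ.+-identityʳ p)))
    (ℚₚ.+-monoʳ-≤ p (ℚₚ.+-mono-≤ (1/1+-nonNeg m) (1/1+-nonNeg n)))

fromℚ : ℚᵘ → ℝ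
fromℚ q = mkℝ (λ _ → q) (p≤p+ε q)

0ℝ : ℝ
0ℝ = fromℚ 0ℚᵘ

odd : ℕ → ℕ
odd n = suc (n ℕ.+ n)

private
  half+half : ∀ n → 1/1+ odd n ℚ.+ 1/1+ odd n ≃ 1/1+ n
  half+half n = *≡* (solve 1
    (λ k → let h = con (+ 1) :+ ((con (+ 1) :+ k) :+ k) in
      (con (+ 1) :* h :+ con (+ 1) :* h) :* (con (+ 1) :+ k)
      := con (+ 1) :* (h :* h)) refl (+ n))
    where open ℤSolver.+-*-Solver

  shuffle : ∀ a b c d → (a ℚ.+ (c ℚ.+ d)) ℚ.+ (b ℚ.+ (c ℚ.+ d))
                      ≃ (a ℚ.+ b) ℚ.+ ((c ℚ.+ c) ℚ.+ (d ℚ.+ d))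
  shuffle = solve 4
    (λ a b c d → (a :+ (c :+ d)) :+ (b :+ (c :+ d))
              := (a :+ b) :+ ((c :+ c) :+ (d :+ d))) ℚₚ.≃-refl
    where open +-*-Solver

-- Each summand is read off at index 2n+1, where its error is 1/(2(n+1)).
_+_ : ℝ → ℝ → ℝ
x + y = mkℝ (λ n → approx x (odd n) ℚ.+ approx y (odd n)) λ m n →
  ℚₚ.≤-trans
    (ℚₚ.+-mono-≤ (regular x (odd m) (odd n)) (regular y (odd m) (odd n)))
    (ℚₚ.≤-reflexive (ℚₚ.≃-trans
      (shuffle (approx x (odd n)) (approx y (odd n)) (1/1+ odd m) (1/1+ odd n))
      (ℚₚ.+-congʳ (approx x (odd n) ℚ.+ approx y (odd n))
        (ℚₚ.+-cong (half+half m) (half+half n)))))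

_⊔_ : ℝ → ℝ → ℝ
x ⊔ y = mkℝ (λ n → approx x n ℚ.⊔ approx y n) λ m n →
  ℚₚ.⊔-lub
    (ℚₚ.≤-trans (regular x m n)
      (ℚₚ.+-monoˡ-≤ (1/1+ m ℚ.+ 1/1+ n) (ℚₚ.p≤p⊔q (approx x n) (approx y n))))
    (ℚₚ.≤-trans (regular y m n)
      (ℚₚ.+-monoˡ-≤ (1/1+ m ℚ.+ 1/1+ n) (ℚₚ.p≤q⊔p (approx x n) (approx y n))))

-- Weights lie in [0,∞], with nothing standing for ∞.
record Graph : Set where
  field
    size   : ℕ
    d      : Fin size → Fin size → Maybe ℝ
    nonNeg : ∀ i j w → d i j ≡ just w → 0ℝ ≤ w

  Node : Set
  Node = Fin size

  Edge : Node → Node → Set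
  Edge i j = ∃ λ w → d i j ≡ just w

  -- Nonempty directed paths. Nodes may repeat: this changes neither
  -- reachability, nor the existence of cycles, nor the minimum over paths of
  -- the largest edge weight.
  Path : Node → Node → Set
  Path = TransClosure Edge

  maxWeight : ∀ {i j} → Path i j → ℝ
  maxWeight [ e ]   = proj₁ e
  maxWeight (e ∷ π) = proj₁ e ⊔ maxWeight π

  IsUltrametricDistance : Node → Node → ℝ → Set
  IsUltrametricDistance i j δ =
    (Σ (Path i j) λ π → maxWeight π ≈ δ) × (∀ (π : Path i j) → δ ≤ maxWeight π)

  BackboneEdge : Node → Node → Set
  BackboneEdge i j =
    ∃ λ w → d i j ≡ just w × ∃ λ δ → IsUltrametricDistance i j δ × w ≈ δ

  NoSelfLoops : Set
  NoSelfLoops = ∀ i → d i i ≡ nothing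

  PositiveWeights : Set
  PositiveWeights = ∀ i j w → d i j ≡ just w → 0ℝ < w

-- A subgraph keeps the weights of the edges it retains; out i is the set of
-- heads of its edges leaving i.
record Subgraph (G : Graph) : Set where
  open Graph G
  field
    nodes     : Subset size
    out       : Node → Subset size
    isEdge    : ∀ i j → j ∈ out i → Edge i j
    endpoints : ∀ i j → j ∈ out i → i ∈ nodes × j ∈ nodes

  SubEdge : Node → Node → Set
  SubEdge i j = j ∈ out i

  SubPath : Node → Node → Set
  SubPath = TransClosure SubEdge

  -- By isEdge, the default value of fromMaybe is never used.
  weight : ℝ
  weight = ∑ λ i → ∑ λ j → if lookup (out i) j then fromMaybe 0ℝ (d i j) else 0ℝ
    where
    ∑ : (Node → ℝ) → ℝ
    ∑ = foldr _+_ 0ℝ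

module _ (G : Graph) where
  open Graph G
  open Subgraph

  -- No in-degree condition is imposed.  Rootedness says that the root belongs
  -- to the subgraph and reaches each of its other nodes inside it.
  record IsArborescence (r : Node) (T : Subgraph G) : Set where
    field
      acyclic   : ∀ i → ¬ SubPath T i i
      root      : r ∈ nodes T
      rooted    : ∀ i → i ∈ nodes T → i ≢ r → SubPath T r i
      preserves : ∀ i → i ≢ r → Path r i → SubPath T r i

  IsMinimumArborescence : Node → Subgraph G → Set
  IsMinimumArborescence r T =
    IsArborescence r T × (∀ T′ → IsArborescence r T′ → weight T ≤ weight T′)

  ArborescenceUnionEdge : Node → Node → Set
  ArborescenceUnionEdge i j =
    ∃ λ r → Σ (Subgraph G) λ T → IsMinimumArborescence r T × SubEdge T i j

{-# OPTIONS --safe #-}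
module Submission where

-- The witness has nodes 0, 1, 2 and the edges
--
--   0 → 1 (weight 3),   1 → 2 (weight 3),   0 → 2 (weight 4),   2 → 1 (weight 1).
--
-- The backbone compares single edges: it keeps 0 → 1, because every edge leaving
-- 0 weighs at least 3 (backbone-0→1), and drops 0 → 2, because 0 → 1 → 2 uses
-- only edges of weight 3 < 4 (¬backbone-0→2).  Arborescences compare sums: an
-- arborescence at 0 has an edge into 1 and an edge into 2, and so it contains one
-- of the edge sets
--
--   0 → 2 → 1 (weight 5),   0 → 1 → 2 (weight 6),   0 → 1 with 0 → 2 (weight 7),
--
-- since 1 → 2 with 2 → 1 is a cycle.  As the weight grows with the edge set
-- (edgeWeight⊑weight), the first is minimum (minimum-tree021), and 0 → 2 lies in
-- the union.  An arborescence at 0 through 0 → 1 weighs at least 6 and is not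
-- minimum (¬minimum-through01).  No edge enters 0, so the arborescences at the
-- other roots do not contain the node 0 (through01⇒root0).

open import Defs
open import Data.Bool using (true; false; if_then_else_)
open import Data.Empty using (⊥-elim)
open import Data.Fin using (Fin; zero; suc; _≟_)
open import Data.Fin.Patterns using (0F; 1F; 2F)
open import Data.Fin.Subset using (Subset; _∈_; _⊆_; ⁅_⁆; _∪_; ⊤; ⊥)
open import Data.Fin.Subset.Properties using (∈⊤; ∉⊥; x∈⁅x⁆; x∈⁅y⁆⇒x≡y; x∈p∪q⁻)
open import Data.Integer using (+_)
open import Data.Maybe using (Maybe; just; nothing; fromMaybe)
open import Data.Nat as ℕ using (ℕ; zero; suc)
import Data.Nat.Properties as ℕₚ
open import Data.Product using (Σ; ∃; _×_; ∃₂; _,_; proj₁)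
open import Data.Rational.Unnormalised as ℚ using (ℚᵘ; mkℚᵘ; 0ℚᵘ)
import Data.Rational.Unnormalised.Properties as ℚₚ
open import Data.Sum using (_⊎_; inj₁; inj₂; [_,_]′)
open import Data.Vec using (lookup)
open import Data.Vec.Functional using (foldr)
open import Data.Vec.Properties using ([]=⇒lookup; lookup⇒[]=)
open import Relation.Binary.Construct.Closure.Transitive using (TransClosure; [_]; _∷_)
open import Relation.Binary.PropositionalEquality using (_≡_; _≢_; refl; sym; subst)
open import Relation.Nullary using (¬_; yes; no)
open import Relation.Nullary.Decidable using (from-yes; from-no)

-- Pointwise comparison of real numbers

infix 4 _⊑_

-- Termwise order.  For approximating sequences it is stronger than _≤_, and its
-- transitivity and compatibility with _+_ are immediate from those of ℚᵘ.  It
-- relates sequences, not elements of ℝ, so that regularity proofs play no part.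
_⊑_ : (x y : ℕ → ℚᵘ) → Set
x ⊑ y = ∀ n → x n ℚ.≤ y n

-- The slack allowed at index n by _≤_ and _<_.
ε : ℕ → ℚᵘ
ε n = 1/1+ n ℚ.+ 1/1+ n

⊑-refl : ∀ {x} → x ⊑ x
⊑-refl _ = ℚₚ.≤-refl

⊑-trans : ∀ {x y z} → x ⊑ y → y ⊑ z → x ⊑ z
⊑-trans p q n = ℚₚ.≤-trans (p n) (q n)

⊑⇒≤ : ∀ x y → approx x ⊑ approx y → x ≤ y
⊑⇒≤ x y p n = ℚₚ.≤-trans (regular x n n) (ℚₚ.+-monoˡ-≤ (ε n) (p n))

-- Finite sums, unfolding to the same foldr as the weight of a subgraph.
∑ : ∀ {n} → (Fin n → ℝ) → ℝ
∑ = foldr _+_ 0ℝ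

∑-mono : ∀ n {f g : Fin n → ℝ} → (∀ i → approx (f i) ⊑ approx (g i)) →
         approx (∑ f) ⊑ approx (∑ g)
∑-mono zero    p n = ℚₚ.≤-refl
∑-mono (suc m) p n =
  ℚₚ.+-mono-≤ (p zero (odd n)) (∑-mono m (λ i → p (suc i)) (odd n))

if-mono : ∀ {z w} b b′ → approx z ⊑ approx w → (b ≡ true → b′ ≡ true) →
          approx (if b then w else z) ⊑ approx (if b′ then w else z)
if-mono false false _   _    _ = ℚₚ.≤-refl
if-mono false true  z⊑w _      = z⊑w
if-mono true  true  _   _    _ = ℚₚ.≤-refl
if-mono true  false _   b⇒b′ with () ← b⇒b′ refl

fromMaybe-⊒0 : ∀ m → (∀ w → m ≡ just w → approx 0ℝ ⊑ approx w) →
               approx 0ℝ ⊑ approx (fromMaybe 0ℝ m)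
fromMaybe-⊒0 (just w) 0⊑w = 0⊑w w refl
fromMaybe-⊒0 nothing  _ _ = ℚₚ.≤-refl

-- Edge sets and paths in general graphs

module _ (G : Graph) where
  open Graph G

  -- The sum of d i j over the pairs with j ∈ out i, where a pair without an
  -- edge counts 0.  For a subgraph T, edgeWeight (Subgraph.out T) is
  -- definitionally the weight of T.
  edgeWeight : (Node → Subset size) → ℝ
  edgeWeight out =
    ∑ λ i → ∑ λ j → if lookup (out i) j then fromMaybe 0ℝ (d i j) else 0ℝ

  edgeWeight⊑weight : (∀ i j w → d i j ≡ just w → approx 0ℝ ⊑ approx w) →
                      ∀ out′ (T : Subgraph G) → (∀ i → out′ i ⊆ Subgraph.out T i) →
                      approx (edgeWeight out′) ⊑ approx (Subgraph.weight T)
  edgeWeight⊑weight 0⊑d out′ T out′⊆T =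
    ∑-mono size λ i → ∑-mono size λ j →
      if-mono (lookup (out′ i) j) (lookup (Subgraph.out T i) j)
              (fromMaybe-⊒0 (d i j) (0⊑d i j)) λ e →
        []=⇒lookup (out′⊆T i (lookup⇒[]= j (out′ i) e))

lastStep : ∀ {A : Set} {R : A → A → Set} {i j} →
           TransClosure R i j → ∃ λ k → R k j
lastStep [ e ]   = _ , e
lastStep (_ ∷ π) = lastStep π

ranked⇒acyclic : ∀ {A : Set} {R : A → A → Set} (rank : A → ℕ) →
                 (∀ {i j} → R i j → rank i ℕ.< rank j) →
                 ∀ i → ¬ TransClosure R i i
ranked⇒acyclic {R = R} rank asc i π = ℕₚ.<-irrefl refl (ascends π)
  where
  ascends : ∀ {i j} → TransClosure R i j → rank i ℕ.< rank j
  ascends [ e ]   = asc e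
  ascends (e ∷ π) = ℕₚ.<-trans (asc e) (ascends π)

-- The graph and its backbone

1ℝ 3ℝ 4ℝ : ℝ
1ℝ = fromℚ (mkℚᵘ (+ 1) 0)
3ℝ = fromℚ (mkℚᵘ (+ 3) 0)
4ℝ = fromℚ (mkℚᵘ (+ 4) 0)

weights : Fin 3 → Fin 3 → Maybe ℝ
weights 0F 1F = just 3ℝ
weights 1F 2F = just 3ℝ
weights 0F 2F = just 4ℝ
weights 2F 1F = just 1ℝ
weights _  _  = nothing

-- Every property of the weights that is needed for all edges is checked on the
-- three values that occur.
weights-elim : (P : ℝ → Set) → P 1ℝ → P 3ℝ → P 4ℝ →
               ∀ i j w → weights i j ≡ just w → P w
weights-elim P p1 p3 p4 0F 1F _ refl = p3
weights-elim P p1 p3 p4 1F 2F _ refl = p3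
weights-elim P p1 p3 p4 0F 2F _ refl = p4
weights-elim P p1 p3 p4 2F 1F _ refl = p1

weights-⊒0 : ∀ i j w → weights i j ≡ just w → approx 0ℝ ⊑ approx w
weights-⊒0 = weights-elim (λ w → approx 0ℝ ⊑ approx w)
  (λ _ → from-yes (0ℚᵘ ℚₚ.≤? mkℚᵘ (+ 1) 0))
  (λ _ → from-yes (0ℚᵘ ℚₚ.≤? mkℚᵘ (+ 3) 0))
  (λ _ → from-yes (0ℚᵘ ℚₚ.≤? mkℚᵘ (+ 4) 0))

-- The graph on the nodes 0, 1, 2 described at the top.
G : Graph
G = record
  { size   = 3
  ; d      = weights
  ; nonNeg = λ i j w e → ⊑⇒≤ 0ℝ w (weights-⊒0 i j w e)
  }

open Graph G
open Subgraph

noSelfLoops : NoSelfLoops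
noSelfLoops 0F = refl
noSelfLoops 1F = refl
noSelfLoops 2F = refl

¬loop : ∀ i → ¬ Edge i i
¬loop 0F (_ , ())
¬loop 1F (_ , ())
¬loop 2F (_ , ())

positiveWeights : PositiveWeights
positiveWeights = weights-elim (0ℝ <_)
  -- At index 2 the error is 2/3, below every weight.
  (2 , from-yes (0ℚᵘ ℚ.+ ε 2 ℚₚ.<? mkℚᵘ (+ 1) 0))
  (2 , from-yes (0ℚᵘ ℚ.+ ε 2 ℚₚ.<? mkℚᵘ (+ 3) 0))
  (2 , from-yes (0ℚᵘ ℚ.+ ε 2 ℚₚ.<? mkℚᵘ (+ 4) 0))

0→1 : Edge 0F 1F
0→1 = 3ℝ , refl

1→2 : Edge 1F 2F
1→2 = 3ℝ , refl

0→2 : Edge 0F 2F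
0→2 = 4ℝ , refl

0→1→2 : Path 0F 2F
0→1→2 = _∷_ {y = 1F} 0→1 [ 1→2 ]

edgeFrom0-⊒3 : ∀ {j} (e : Edge 0F j) → approx 3ℝ ⊑ approx (proj₁ e)
edgeFrom0-⊒3 {1F} (_ , refl) _ = ℚₚ.≤-refl
edgeFrom0-⊒3 {2F} (_ , refl) _ = from-yes (mkℚᵘ (+ 3) 0 ℚₚ.≤? mkℚᵘ (+ 4) 0)

pathFrom0-⊒3 : ∀ {j} (π : Path 0F j) → approx 3ℝ ⊑ approx (maxWeight π)
pathFrom0-⊒3 [ e ]     = edgeFrom0-⊒3 e
pathFrom0-⊒3 (e ∷ π) n = ℚₚ.≤-trans (edgeFrom0-⊒3 e n)
  (ℚₚ.p≤p⊔q (approx (proj₁ e) n) (approx (maxWeight π) n))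

backbone-0→1 : BackboneEdge 0F 1F
backbone-0→1 = 3ℝ , refl , 3ℝ ,
  (([ 0→1 ] , 3≈3) , λ π → ⊑⇒≤ 3ℝ (maxWeight π) (pathFrom0-⊒3 π)) , 3≈3
  where
  3≈3 : 3ℝ ≈ 3ℝ
  3≈3 = ⊑⇒≤ 3ℝ 3ℝ ⊑-refl , ⊑⇒≤ 3ℝ 3ℝ ⊑-refl

¬backbone-0→2 : ¬ BackboneEdge 0F 2F
¬backbone-0→2 (_ , refl , δ , (_ , δ-least) , (4≤δ , _)) =
  -- At index 7 the two comparisons give 4 ≤ 3 + 4/8.
  from-no (approx 4ℝ 7 ℚₚ.≤? (approx 3ℝ 7 ℚ.+ ε 7) ℚ.+ ε 7)
    (ℚₚ.≤-trans (4≤δ 7) (ℚₚ.+-monoˡ-≤ (ε 7) (δ-least 0→1→2 7)))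

-- Minimum arborescences

-- The arborescences at 0 with a single edge into each of 1 and 2, as edge sets:
-- 0 → 2 → 1, 0 → 1 → 2, and 0 → 1 with 0 → 2.
out021 out012 out01-02 : Node → Subset 3
out021 0F = ⁅ 2F ⁆
out021 1F = ⊥
out021 2F = ⁅ 1F ⁆
out012 0F = ⁅ 1F ⁆
out012 1F = ⁅ 2F ⁆
out012 2F = ⊥
out01-02 0F = ⁅ 1F ⁆ ∪ ⁅ 2F ⁆
out01-02 1F = ⊥
out01-02 2F = ⊥

w021⊑w012 : approx (edgeWeight G out021) ⊑ approx (edgeWeight G out012)
w021⊑w012 n =
  from-yes (approx (edgeWeight G out021) n ℚₚ.≤? approx (edgeWeight G out012) n)

w012⊑w01-02 : approx (edgeWeight G out012) ⊑ approx (edgeWeight G out01-02)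
w012⊑w01-02 n =
  from-yes (approx (edgeWeight G out012) n ℚₚ.≤? approx (edgeWeight G out01-02) n)

singleton⊆ : ∀ {n} {x : Fin n} {p} → x ∈ p → ⁅ x ⁆ ⊆ p
singleton⊆ {p = p} x∈p y∈ = subst (_∈ p) (sym (x∈⁅y⁆⇒x≡y _ y∈)) x∈p

∪⊆ : ∀ {n} {p q r : Subset n} → p ⊆ r → q ⊆ r → p ∪ q ⊆ r
∪⊆ {p = p} {q} p⊆r q⊆r x∈ = [ p⊆r , q⊆r ]′ (x∈p∪q⁻ p q x∈)

module _ (T : Subgraph G) where

  weight-⊒021 : SubEdge T 0F 2F → SubEdge T 2F 1F →
                approx (edgeWeight G out021) ⊑ approx (weight T)
  weight-⊒021 02∈T 21∈T = edgeWeight⊑weight G weights-⊒0 out021 T λ where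
    0F → singleton⊆ 02∈T
    1F → λ j∈ → ⊥-elim (∉⊥ j∈)
    2F → singleton⊆ 21∈T

  weight-⊒012 : SubEdge T 0F 1F → SubEdge T 1F 2F →
                approx (edgeWeight G out012) ⊑ approx (weight T)
  weight-⊒012 01∈T 12∈T = edgeWeight⊑weight G weights-⊒0 out012 T λ where
    0F → singleton⊆ 01∈T
    1F → singleton⊆ 12∈T
    2F → λ j∈ → ⊥-elim (∉⊥ j∈)

  weight-⊒01-02 : SubEdge T 0F 1F → SubEdge T 0F 2F →
                  approx (edgeWeight G out01-02) ⊑ approx (weight T)
  weight-⊒01-02 01∈T 02∈T = edgeWeight⊑weight G weights-⊒0 out01-02 T λ where
    0F → ∪⊆ (singleton⊆ 01∈T) (singleton⊆ 02∈T)
    1F → λ j∈ → ⊥-elim (∉⊥ j∈)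
    2F → λ j∈ → ⊥-elim (∉⊥ j∈)

  module _ (arb : IsArborescence G 0F T) where
    open IsArborescence arb

    enters1 : ∃ λ k → SubEdge T k 1F
    enters1 = lastStep (preserves 1F (λ ()) [ 0→1 ])

    enters2 : ∃ λ k → SubEdge T k 2F
    enters2 = lastStep (preserves 2F (λ ()) [ 0→2 ])

    through01⇒weight-⊒012 : SubEdge T 0F 1F →
                            approx (edgeWeight G out012) ⊑ approx (weight T)
    through01⇒weight-⊒012 01∈T = byEntry enters2
      where
      byEntry : (∃ λ k → SubEdge T k 2F) →
                approx (edgeWeight G out012) ⊑ approx (weight T)
      byEntry (0F , 02∈T) = ⊑-trans w012⊑w01-02 (weight-⊒01-02 01∈T 02∈T)
      byEntry (1F , 12∈T) = weight-⊒012 01∈T 12∈T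
      byEntry (2F , 22∈T) = ⊥-elim (¬loop 2F (isEdge T 2F 2F 22∈T))

    arborescence-weight-⊒021 : approx (edgeWeight G out021) ⊑ approx (weight T)
    arborescence-weight-⊒021 = byEntries enters1 enters2
      where
      byEntries : (∃ λ k → SubEdge T k 1F) → (∃ λ k → SubEdge T k 2F) →
                  approx (edgeWeight G out021) ⊑ approx (weight T)
      byEntries (0F , 01∈T) _ = ⊑-trans w021⊑w012 (through01⇒weight-⊒012 01∈T)
      byEntries (1F , 11∈T) _ = ⊥-elim (¬loop 1F (isEdge T 1F 1F 11∈T))
      byEntries (2F , 21∈T) (0F , 02∈T) = weight-⊒021 02∈T 21∈T
      byEntries (2F , 21∈T) (1F , 12∈T) = ⊥-elim (acyclic 1F (12∈T ∷ [ 21∈T ]))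
      byEntries (2F , 21∈T) (2F , 22∈T) = ⊥-elim (¬loop 2F (isEdge T 2F 2F 22∈T))

tree021-edges : ∀ i j → j ∈ out021 i →
                (i ≡ 0F × j ≡ 2F) ⊎ (i ≡ 2F × j ≡ 1F)
tree021-edges 0F j j∈ = inj₁ (refl , x∈⁅y⁆⇒x≡y 2F j∈)
tree021-edges 1F j j∈ = ⊥-elim (∉⊥ j∈)
tree021-edges 2F j j∈ = inj₂ (refl , x∈⁅y⁆⇒x≡y 1F j∈)

-- The path 0 → 2 → 1 as a subgraph on all three nodes.
tree021 : Subgraph G
tree021 = record
  { nodes     = ⊤
  ; out       = out021
  ; isEdge    = λ i j j∈ → edge (tree021-edges i j j∈)
  ; endpoints = λ _ _ _ → ∈⊤ , ∈⊤
  }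
  where
  edge : ∀ {i j} → (i ≡ 0F × j ≡ 2F) ⊎ (i ≡ 2F × j ≡ 1F) → Edge i j
  edge (inj₁ (refl , refl)) = 4ℝ , refl
  edge (inj₂ (refl , refl)) = 1ℝ , refl

tree021-arborescence : IsArborescence G 0F tree021
tree021-arborescence = record
  { acyclic   = ranked⇒acyclic rank λ {i} {j} j∈ → ascends (tree021-edges i j j∈)
  ; root      = ∈⊤
  ; rooted    = λ i _ → reaches i
  ; preserves = λ i i≢0 _ → reaches i i≢0
  }
  where
  -- The position along the path 0 → 2 → 1.
  rank : Node → ℕ
  rank 0F = 0
  rank 1F = 2
  rank 2F = 1

  ascends : ∀ {i j} → (i ≡ 0F × j ≡ 2F) ⊎ (i ≡ 2F × j ≡ 1F) →
            rank i ℕ.< rank j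
  ascends (inj₁ (refl , refl)) = ℕₚ.≤-refl
  ascends (inj₂ (refl , refl)) = ℕₚ.≤-refl

  reaches : ∀ i → i ≢ 0F → SubPath tree021 0F i
  reaches 0F 0≢0 = ⊥-elim (0≢0 refl)
  reaches 1F _   = x∈⁅x⁆ 2F ∷ [ x∈⁅x⁆ 1F ]
  reaches 2F _   = [ x∈⁅x⁆ 2F ]

minimum-tree021 : IsMinimumArborescence G 0F tree021
minimum-tree021 = tree021-arborescence , λ T arb →
  ⊑⇒≤ (weight tree021) (weight T) (arborescence-weight-⊒021 T arb)

union-0→2 : ArborescenceUnionEdge G 0F 2F
union-0→2 = 0F , tree021 , minimum-tree021 , x∈⁅x⁆ 2F

¬edgeInto0 : ∀ i → ¬ Edge i 0F
¬edgeInto0 0F (_ , ())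
¬edgeInto0 1F (_ , ())
¬edgeInto0 2F (_ , ())

-- A subgraph with the edge 0 → 1 has the node 0, which only the root 0 reaches.
through01⇒root0 : ∀ r T → IsArborescence G r T → SubEdge T 0F 1F → r ≡ 0F
through01⇒root0 r T arb 01∈T with r ≟ 0F
... | yes r≡0 = r≡0
... | no  r≢0
  with k , k0∈T ← lastStep (IsArborescence.rooted arb 0F
                    (proj₁ (endpoints T 0F 1F 01∈T)) (λ 0≡r → r≢0 (sym 0≡r)))
  = ⊥-elim (¬edgeInto0 k (isEdge T k 0F k0∈T))

¬minimum-through01 : ∀ T → IsMinimumArborescence G 0F T → ¬ SubEdge T 0F 1F
¬minimum-through01 T (arb , minimum) 01∈T =
  -- At index 2 the error is 2/3, so minimality would give 6 ≤ 5 + 2/3.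
  from-no (approx (edgeWeight G out012) 2 ℚₚ.≤?
           approx (edgeWeight G out021) 2 ℚ.+ ε 2)
    (ℚₚ.≤-trans (through01⇒weight-⊒012 T arb 01∈T 2)
                (minimum tree021 tree021-arborescence 2))

¬union-0→1 : ¬ ArborescenceUnionEdge G 0F 1F
¬union-0→1 (r , T , minimum , 01∈T) =
  ¬minimum-through01 T
    (subst (λ r′ → IsMinimumArborescence G r′ T)
           (through01⇒root0 r T (proj₁ minimum) 01∈T) minimum)
    01∈T

mainTheorem4 : Σ Graph λ G →
    Graph.NoSelfLoops G
    × Graph.PositiveWeights G
    × (∃₂ λ i j → Graph.BackboneEdge G i j × ¬ ArborescenceUnionEdge G i j)
    × (∃₂ λ i j → ArborescenceUnionEdge G i j × ¬ Graph.BackboneEdge G i j)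
mainTheorem4 = G , noSelfLoops , positiveWeights ,
  (0F , 1F , backbone-0→1 , ¬union-0→1) ,
  (0F , 2F , union-0→2 , ¬backbone-0→2)
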